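{- For every dually vertex-oblique graph $G$ there exists a graph $H$, isomorphic to neither $G$ nor $\overline{G}$, that has the same vertex-type sequence as $G$.
   Context: All graphs are finite and simple. For a vertex $v$ of degree $r$ in a graph $G$ whose neighbours have degrees $x_1 \geq \cdots \geq x_r$ (degrees taken in $G$), the vertex type of $v$ is $t(v) := (x_1,\ldots,x_r)$; vertex types in $\overline{G}$ are computed in $\overline{G}$. A graph is vertex-oblique if distinct vertices have distinct vertex types; it is dually vertex-oblique if it is vertex-oblique and its set of vertex types equals that of its complement $\overline{G}$. The vertex-type sequence of a graph is the multiset of the vertex types of its vertices (listed in non-increasing order, where a longer type is larger and types of equal length are compared lexicographically).
   Formalization: The graph G is assumed to have at least two vertices: the one-vertex graph (and the empty graph) is trivially dually vertex-oblique, but no other graph has its vertex-type sequence, so the claim fails there. -}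

module Defs where

open import Data.Bool using (Bool; true; false; not; _∧_; if_then_else_)
open import Data.Nat using (ℕ; zero; suc; _≤ᵇ_)
open import Data.Fin using (Fin; _≟_)
open import Data.List using (List; []; _∷_; map; filterᵇ; allFin)
open import Data.Nat.ListAction using (sum)
open import Data.List.Relation.Binary.Permutation.Propositional using (_↭_)
open import Data.Fin.Permutation using (Permutation; _⟨$⟩ʳ_)
open import Data.Product using (Σ; _×_; ∃)
open import Relation.Binary.PropositionalEquality using (_≡_)
open import Relation.Nullary using (¬_)
open import Relation.Nullary.Decidable using (⌊_⌋)

record Graph (n : ℕ) : Set where
  field
    adj   : Fin n → Fin n → Bool
    sym   : ∀ u v → adj u v ≡ adj v u
    irrefl : ∀ v → adj v v ≡ false
open Graph public

complement : ∀ {n} → Graph n → Graph n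
complement {n} G = record
  { adj = λ u v → not ⌊ u ≟ v ⌋ ∧ not (adj G u v)
  ; sym = λ u v → sy u v
  ; irrefl = λ v → ir v }
  where
  open import Relation.Binary.PropositionalEquality using (refl; cong; cong₂)
  open import Relation.Nullary using (yes; no)
  import Relation.Binary.PropositionalEquality as Eq
  sy : ∀ u v → (not ⌊ u ≟ v ⌋ ∧ not (adj G u v)) ≡ (not ⌊ v ≟ u ⌋ ∧ not (adj G v u))
  sy u v with u ≟ v | v ≟ u
  ... | yes _ | yes _ = refl
  ... | no _  | no _  = cong not (Graph.sym G u v)
  ... | yes p | no q  = Data.Empty.⊥-elim (q (Eq.sym p)) where import Data.Empty
  ... | no p  | yes q = Data.Empty.⊥-elim (p (Eq.sym q)) where import Data.Empty
  ir : ∀ v → (not ⌊ v ≟ v ⌋ ∧ not (adj G v v)) ≡ false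
  ir v with v ≟ v
  ... | yes _ = refl
  ... | no ¬p = Data.Empty.⊥-elim (¬p refl) where import Data.Empty

degree : ∀ {n} → Graph n → Fin n → ℕ
degree {n} G v = sum (map (λ u → if adj G v u then 1 else 0) (allFin n))

insertDesc : ℕ → List ℕ → List ℕ
insertDesc x [] = x ∷ []
insertDesc x (y ∷ ys) = if y ≤ᵇ x then x ∷ y ∷ ys else y ∷ insertDesc x ys

sortDesc : List ℕ → List ℕ
sortDesc [] = []
sortDesc (x ∷ xs) = insertDesc x (sortDesc xs)

vtype : ∀ {n} → Graph n → Fin n → List ℕ
vtype {n} G v = sortDesc (map (degree G) (filterᵇ (adj G v) (allFin n)))

VertexOblique : ∀ {n} → Graph n → Set
VertexOblique {n} G = ∀ (u v : Fin n) → vtype G u ≡ vtype G v → u ≡ v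

DuallyVertexOblique : ∀ {n} → Graph n → Set
DuallyVertexOblique {n} G =
  VertexOblique G
  × (∀ (u : Fin n) → ∃ λ (v : Fin n) → vtype G u ≡ vtype (complement G) v)
  × (∀ (v : Fin n) → ∃ λ (u : Fin n) → vtype G u ≡ vtype (complement G) v)

Isomorphic : ∀ {m n} → Graph m → Graph n → Set
Isomorphic {m} {n} G H =
  Σ (Permutation m n) λ σ → ∀ (u v : Fin m) → adj G u v ≡ adj H (σ ⟨$⟩ʳ u) (σ ⟨$⟩ʳ v)

-- vertex-type sequence as a multiset: equality up to permutation of the lists
-- (the sorted sequence is the canonical representative of this multiset)
SameVertexTypeSeq : ∀ {m n} → Graph m → Graph n → Set
SameVertexTypeSeq {m} {n} G H = map (vtype G) (allFin m) ↭ map (vtype H) (allFin n)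

{-# OPTIONS --safe #-}
module Submission where

-- Let σ send each vertex u to the vertex whose type in the complement Ḡ is t(u).
-- The type of a vertex in Ḡ is determined by its type in G and the degree
-- sequence, which G and Ḡ share; hence σ is an involution.  The graph
-- G′ = σ⁻¹(Ḡ) has the same type as G at every vertex, but differs from G on
-- every pair of vertices that σ maps to itself.
--
-- Since G ≠ G′ have equally many edges at each vertex into each degree class, G
-- contains a switch: edges ab, cd and non-edges ad, cb with deg a = deg c and
-- deg b = deg d.  Replacing ab, cd by ad, cb yields a graph H with unchanged
-- vertex types.  As types are distinct, an isomorphism H → G is the identity and
-- an isomorphism H → Ḡ is σ.  The former contradicts H ≠ G; the latter means
-- H = G′, which leaves at most one vertex besides a, b, c, d, and then
-- (a c)(b d) is an automorphism of G, so that t(a) = t(c).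

open import Defs
open import Data.Bool using (Bool; true; false; not; _∧_; _xor_; if_then_else_; T)
import Data.Bool.Properties as Bool
open import Data.Empty using (⊥-elim)
open import Data.Fin using (Fin; zero; suc; _≟_)
open import Data.Fin.Permutation using (Permutation; _⟨$⟩ʳ_; permutation; transpose)
import Data.Fin.Permutation as Perm
open import Data.Fin.Properties using (any?)
open import Data.List using (List; []; _∷_; _++_; map; filterᵇ; allFin; length; tabulate)
open import Data.List.Membership.Propositional using (_∈_)
open import Data.List.Membership.Propositional.Properties using (∈-∃++)
open import Data.List.Properties using (map-tabulate; map-cong)
open import Data.List.Relation.Binary.Permutation.Propositional using (_↭_; refl; prep; swap; trans; ↭-refl; ↭-sym; ↭-trans; ↭-reflexive)
open import Data.List.Relation.Binary.Permutation.Propositional.Properties using (map⁺; ↭-length; shift)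
open import Data.List.Relation.Unary.Any using (here; there)
open import Data.Nat using (ℕ; zero; suc; _+_; _∸_; _≤_; _<_; _≡ᵇ_; _≤ᵇ_; z≤n; s≤s; _<?_)
import Data.Nat as ℕ
import Data.Nat.ListAction as ListAction
open import Data.Nat.ListAction.Properties using (sum-↭)
open import Data.Nat.Properties hiding (_≟_)
open import Data.Product using (Σ; ∃; _×_; _,_; proj₁; proj₂)
open import Data.Unit using (tt)
open import Function using (_∘_; id; const; mk⇔)
open import Relation.Binary.Definitions using (tri<; tri≈; tri>)
open import Relation.Binary.PropositionalEquality using (_≡_; _≢_; refl; cong; cong₂; subst; module ≡-Reasoning) renaming (sym to ≡-sym; trans to ≡-trans)
open import Relation.Nullary using (¬_; Dec; yes; no; contradiction; ¬?; _×-dec_)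
open import Relation.Nullary.Decidable using (⌊_⌋; dec-true; dec-false; does-⇔)
open import Algebra.Properties.CommutativeMonoid.Sum +-0-commutativeMonoid using (sum; sum-permute; sum-cong-≗; ∑-distrib-+; sum-replicate-zero)

private variable
  m n : ℕ

-- Sums of indicator functions

ind : Bool → ℕ
ind b = if b then 1 else 0

ind-mono : ∀ {x y} → (x ≡ true → y ≡ true) → ind x ≤ ind y
ind-mono {false} _ = z≤n
ind-mono {true}  h = ≤-reflexive (cong ind (≡-sym (h refl)))

ind-injective : ∀ {x y} → ind x ≡ ind y → x ≡ y
ind-injective {false} {false} _ = refl
ind-injective {true}  {true}  _ = refl

sum-map-allFin : (f : Fin n → ℕ) → ListAction.sum (map f (allFin n)) ≡ sum f
sum-map-allFin f = ≡-trans (cong ListAction.sum (map-tabulate id f)) (sum-tabulate f)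
  where
  sum-tabulate : ∀ {n} (f : Fin n → ℕ) → ListAction.sum (tabulate f) ≡ sum f
  sum-tabulate {zero}  f = refl
  sum-tabulate {suc n} f = cong (f zero +_) (sum-tabulate (f ∘ suc))

sum-mono-≤ : {f g : Fin n → ℕ} → (∀ u → f u ≤ g u) → sum f ≤ sum g
sum-mono-≤ {zero}  _   = z≤n
sum-mono-≤ {suc n} f≤g = +-mono-≤ (f≤g zero) (sum-mono-≤ (f≤g ∘ suc))

sum-mono-< : {f g : Fin n → ℕ} → (∀ u → f u ≤ g u) → ∀ x → f x < g x → sum f < sum g
sum-mono-< f≤g zero    fx<gx = +-mono-<-≤ fx<gx (sum-mono-≤ (f≤g ∘ suc))
sum-mono-< f≤g (suc x) fx<gx = +-mono-≤-< (f≤g zero) (sum-mono-< (f≤g ∘ suc) x fx<gx)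

sum-const-1 : ∀ n → sum {n} (const 1) ≡ n
sum-const-1 zero    = refl
sum-const-1 (suc n) = cong suc (sum-const-1 n)

sum-ind≤n : (p : Fin n → Bool) → sum (ind ∘ p) ≤ n
sum-ind≤n {n} p = ≤-trans (sum-mono-≤ (λ u → ind-mono {p u} {true} (const refl))) (≤-reflexive (sum-const-1 n))

sum-≟ : (x : Fin n) (p : Fin n → Bool) → sum (λ u → ind (⌊ x ≟ u ⌋ ∧ p u)) ≡ ind (p x)
sum-≟ {suc n} zero    p = ≡-trans (cong (ind (p zero) +_) (sum-replicate-zero n)) (+-identityʳ _)
sum-≟ {suc n} (suc x) p = ≡-trans (sum-cong-≗ (λ u → cong (λ b → ind (b ∧ p (suc u))) (≟-suc u))) (sum-≟ x (p ∘ suc))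
  where
  ≟-suc : ∀ u → ⌊ suc x ≟ suc u ⌋ ≡ ⌊ x ≟ u ⌋
  ≟-suc u with x ≟ u
  ... | yes _ = refl
  ... | no  _ = refl

-- A strict inequality at `x`, in either direction, would make the sums unequal. Later this recovers
-- an adjacency from a degree.
sum-agree-off : {f g : Fin n → ℕ} → sum f ≡ sum g → ∀ x → (∀ u → u ≢ x → f u ≡ g u) → f x ≡ g x
sum-agree-off {f = f} {g} Σf≡Σg x off =
  ≤-antisym (≮⇒≥ λ lt → <-irrefl (≡-sym Σf≡Σg) (strict (λ u → ≡-sym ∘ off u) lt))
            (≮⇒≥ λ lt → <-irrefl Σf≡Σg (strict off lt))
  where
  strict : {f g : Fin _ → ℕ} → (∀ u → u ≢ x → f u ≡ g u) → f x < g x → sum f < sum g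
  strict {f} {g} off lt = sum-mono-< le x lt
    where
    le : ∀ u → f u ≤ g u
    le u with u ≟ x
    ... | yes refl = <⇒≤ lt
    ... | no u≢x   = ≤-reflexive (off u u≢x)

-- Pigeonhole: without such a `w`, `g` would lie below `f` throughout the class `p`, strictly at
-- `u`, and the counts would differ.
exchange : (f g p : Fin n → Bool) → sum (λ u → ind (f u ∧ p u)) ≡ sum (λ u → ind (g u ∧ p u)) →
  ∀ u → f u ≡ true → g u ≡ false → p u ≡ true →
  ∃ λ w → f w ≡ false × g w ≡ true × p w ≡ true
exchange f g p Σf≡Σg u fu gu pu
  with any? (λ w → (f w Bool.≟ false) ×-dec (g w Bool.≟ true) ×-dec (p w Bool.≟ true))
... | yes found = found
... | no none   = contradiction (sum-mono-< le u lt) (<-irrefl (≡-sym Σf≡Σg))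
  where
  le : ∀ w → ind (g w ∧ p w) ≤ ind (f w ∧ p w)
  le w with f w in fw | g w in gw | p w in pw
  ... | true  | true  | true  = ≤-refl
  ... | true  | true  | false = ≤-refl
  ... | true  | false | _     = z≤n
  ... | false | false | _     = z≤n
  ... | false | true  | false = z≤n
  ... | false | true  | true  = ⊥-elim (none (w , fw , gw , pw))
  lt : ind (g u ∧ p u) < ind (f u ∧ p u)
  lt rewrite fu | gu | pu = ≤-refl

-- Vertex types as multiplicity functions

occurrences : ℕ → List ℕ → ℕ
occurrences j xs = ListAction.sum (map (λ y → ind (y ≡ᵇ j)) xs)

occurrences-↭ : ∀ j {xs ys} → xs ↭ ys → occurrences j xs ≡ occurrences j ys
occurrences-↭ j p = sum-↭ (map⁺ _ p)

≡ᵇ-refl : ∀ k → (k ≡ᵇ k) ≡ true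
-- `does (k ℕ.≟ k)` computes to `k ≡ᵇ k`, so `dec-true` settles the Boolean test; `≤ᵇ` is handled in
-- the same way through `ℕ.≤?`.
≡ᵇ-refl k = dec-true (k ℕ.≟ k) refl

occurs⇒∈ : ∀ j xs → occurrences j xs ≢ 0 → j ∈ xs
occurs⇒∈ j []       h = ⊥-elim (h refl)
occurs⇒∈ j (x ∷ xs) h with x ℕ.≟ j
... | yes x≡j = here (≡-sym x≡j)
... | no  x≢j = there (occurs⇒∈ j xs λ e → h (cong₂ _+_ (cong ind (dec-false (x ℕ.≟ j) x≢j)) e))

occurrences-head≢0 : ∀ x xs → occurrences x (x ∷ xs) ≢ 0
occurrences-head≢0 x xs e rewrite ≡ᵇ-refl x with () ← e

-- Induction on `xs`: its head occurs in `ys` and can be removed there, after which the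
-- multiplicities still agree.
occurrences⇒↭ : ∀ xs ys → (∀ j → occurrences j xs ≡ occurrences j ys) → xs ↭ ys
occurrences⇒↭ []       []       _ = ↭-refl
occurrences⇒↭ []       (y ∷ ys) h = ⊥-elim (occurrences-head≢0 y ys (≡-sym (h y)))
occurrences⇒↭ (x ∷ xs) ys       h
  with as , bs , refl ← ∈-∃++ (occurs⇒∈ x ys λ e → occurrences-head≢0 x xs (≡-trans (h x) e))
  = ↭-trans (prep x (occurrences⇒↭ xs (as ++ bs) tail-occurrences)) (↭-sym (shift x as bs))
  where
  tail-occurrences : ∀ j → occurrences j xs ≡ occurrences j (as ++ bs)
  tail-occurrences j = +-cancelˡ-≡ (ind (x ≡ᵇ j)) _ _ (≡-trans (h j) (occurrences-↭ j (shift x as bs)))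

insertDesc-↭ : ∀ x xs → insertDesc x xs ↭ x ∷ xs
insertDesc-↭ x []       = ↭-refl
insertDesc-↭ x (y ∷ ys) with y ≤ᵇ x
... | true  = ↭-refl
... | false = ↭-trans (prep y (insertDesc-↭ x ys)) (swap y x ↭-refl)

sortDesc-↭ : ∀ xs → sortDesc xs ↭ xs
sortDesc-↭ []       = ↭-refl
sortDesc-↭ (x ∷ xs) = ↭-trans (insertDesc-↭ x (sortDesc xs)) (prep x (sortDesc-↭ xs))

-- As `x < y`, the head `z` is at most both, between them or above both; `z ≤ x` without `z ≤ y` is
-- impossible.
insertDesc-comm-< : ∀ {x y} → x < y → ∀ zs → insertDesc x (insertDesc y zs) ≡ insertDesc y (insertDesc x zs)
insertDesc-comm-< {x} {y} x<y []
  rewrite dec-true (x ℕ.≤? y) (<⇒≤ x<y) | dec-false (y ℕ.≤? x) (<⇒≱ x<y) = refl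
insertDesc-comm-< {x} {y} x<y (z ∷ zs) with z ℕ.≤? x | z ℕ.≤? y
... | yes z≤x | no  z≰y = ⊥-elim (z≰y (≤-trans z≤x (<⇒≤ x<y)))
... | yes z≤x | yes z≤y
  rewrite dec-true (z ℕ.≤? x) z≤x | dec-true (z ℕ.≤? y) z≤y
        | dec-true (x ℕ.≤? y) (<⇒≤ x<y) | dec-false (y ℕ.≤? x) (<⇒≱ x<y) | dec-true (z ℕ.≤? x) z≤x = refl
... | no  z≰x | yes z≤y
  rewrite dec-false (z ℕ.≤? x) z≰x | dec-true (z ℕ.≤? y) z≤y
        | dec-false (y ℕ.≤? x) (<⇒≱ x<y) | dec-false (z ℕ.≤? x) z≰x = refl
... | no  z≰x | no  z≰y
  rewrite dec-false (z ℕ.≤? x) z≰x | dec-false (z ℕ.≤? y) z≰y | dec-false (z ℕ.≤? x) z≰x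
  = cong (z ∷_) (insertDesc-comm-< x<y zs)

insertDesc-comm : ∀ x y zs → insertDesc x (insertDesc y zs) ≡ insertDesc y (insertDesc x zs)
insertDesc-comm x y zs with <-cmp x y
... | tri< x<y _ _ = insertDesc-comm-< x<y zs
... | tri≈ _ refl _ = refl
... | tri> _ _ y<x = ≡-sym (insertDesc-comm-< y<x zs)

-- No sortedness is proved: since insertions commute, permuted lists already sort to the same list.
sortDesc-cong : ∀ {xs ys} → xs ↭ ys → sortDesc xs ≡ sortDesc ys
sortDesc-cong refl          = refl
sortDesc-cong (prep x p)    = cong (insertDesc x) (sortDesc-cong p)
sortDesc-cong (swap {xs} x y p) = ≡-trans (insertDesc-comm x y (sortDesc xs)) (cong (insertDesc y ∘ insertDesc x) (sortDesc-cong p))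
sortDesc-cong (trans p q)   = ≡-trans (sortDesc-cong p) (sortDesc-cong q)

hasDegree : Graph n → ℕ → Fin n → Bool
hasDegree G j u = degree G u ≡ᵇ j

-- The class `p` is free, so that neighbours in one graph can be counted by degrees taken in
-- another; `const true` gives the degree.
neighbours : Graph n → Fin n → (Fin n → Bool) → ℕ
neighbours G v p = sum λ u → ind (adj G v u ∧ p u)

hasDegree-true : (G : Graph n) → ∀ {j u} → degree G u ≡ j → hasDegree G j u ≡ true
hasDegree-true G = dec-true (_ ℕ.≟ _)

hasDegree⇒≡ : (G : Graph n) → ∀ {j u} → hasDegree G j u ≡ true → degree G u ≡ j
hasDegree⇒≡ G e = ≡ᵇ⇒≡ _ _ (subst T (≡-sym e) tt)

degree-sum : (G : Graph n) → ∀ v → degree G v ≡ sum (λ u → ind (adj G v u))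
degree-sum G v = sum-map-allFin (λ u → ind (adj G v u))

occurrences-vtype : (G : Graph n) → ∀ v j → occurrences j (vtype G v) ≡ neighbours G v (hasDegree G j)
occurrences-vtype {n} G v j =
  ≡-trans (occurrences-↭ j (sortDesc-↭ (map (degree G) (filterᵇ (adj G v) (allFin n)))))
    (≡-trans (filtered (allFin n)) (sum-map-allFin (λ u → ind (adj G v u ∧ hasDegree G j u))))
  where
  filtered : ∀ us → occurrences j (map (degree G) (filterᵇ (adj G v) us))
    ≡ ListAction.sum (map (λ u → ind (adj G v u ∧ hasDegree G j u)) us)
  filtered []       = refl
  filtered (u ∷ us) with adj G v u
  ... | true  = cong (ind (hasDegree G j u) +_) (filtered us)
  ... | false = filtered us

length-vtype : (G : Graph n) → ∀ v → length (vtype G v) ≡ degree G v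
length-vtype {n} G v = ≡-trans (↭-length (sortDesc-↭ (map (degree G) (filterᵇ (adj G v) (allFin n))))) (filtered (allFin n))
  where
  filtered : ∀ us → length (map (degree G) (filterᵇ (adj G v) us)) ≡ ListAction.sum (map (λ u → ind (adj G v u)) us)
  filtered []       = refl
  filtered (u ∷ us) with adj G v u
  ... | true  = cong suc (filtered us)
  ... | false = filtered us

module _ (G : Graph m) (H : Graph n) where

  vtype⇒degree : ∀ {u v} → vtype G u ≡ vtype H v → degree G u ≡ degree H v
  vtype⇒degree {u} {v} e = ≡-trans (≡-sym (length-vtype G u)) (≡-trans (cong length e) (length-vtype H v))

  vtype⇒neighbours : ∀ {u v} → vtype G u ≡ vtype H v →
    ∀ j → neighbours G u (hasDegree G j) ≡ neighbours H v (hasDegree H j)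
  vtype⇒neighbours {u} {v} e j =
    ≡-trans (≡-sym (occurrences-vtype G u j)) (≡-trans (cong (occurrences j) e) (occurrences-vtype H v j))

  neighbours⇒vtype : ∀ {u v} → (∀ j → neighbours G u (hasDegree G j) ≡ neighbours H v (hasDegree H j)) →
    vtype G u ≡ vtype H v
  neighbours⇒vtype {u} {v} h = sortDesc-cong (occurrences⇒↭ xs ys λ j → begin
    occurrences j xs             ≡⟨ occurrences-↭ j (sortDesc-↭ xs) ⟨
    occurrences j (vtype G u)    ≡⟨ occurrences-vtype G u j ⟩
    neighbours G u (hasDegree G j) ≡⟨ h j ⟩
    neighbours H v (hasDegree H j) ≡⟨ occurrences-vtype H v j ⟨
    occurrences j (vtype H v)    ≡⟨ occurrences-↭ j (sortDesc-↭ ys) ⟩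
    occurrences j ys             ∎)
    where
    open ≡-Reasoning
    xs = map (degree G) (filterᵇ (adj G u) (allFin m))
    ys = map (degree H) (filterᵇ (adj H v) (allFin n))

  module _ (ρ : Permutation m n) {u v} (adj≡ : ∀ w → adj G u w ≡ adj H v (ρ ⟨$⟩ʳ w)) where

    degree-permute : degree G u ≡ degree H v
    degree-permute = begin
      degree G u                              ≡⟨ degree-sum G u ⟩
      sum (λ w → ind (adj G u w))             ≡⟨ sum-cong-≗ (λ w → cong ind (adj≡ w)) ⟩
      sum (λ w → ind (adj H v (ρ ⟨$⟩ʳ w)))    ≡⟨ sum-permute (λ w → ind (adj H v w)) ρ ⟨
      sum (λ w → ind (adj H v w))             ≡⟨ degree-sum H v ⟨
      degree H v                              ∎
      where open ≡-Reasoning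

    -- `ρ` matches only the neighbourhoods of `u` and `v` and need not be an isomorphism. For a
    -- switch it will vary with the vertex.
    vtype-permute : (∀ w → degree G w ≡ degree H (ρ ⟨$⟩ʳ w)) → vtype G u ≡ vtype H v
    vtype-permute deg≡ = neighbours⇒vtype λ j → ≡-trans
      (sum-cong-≗ λ w → cong ind (cong₂ _∧_ (adj≡ w) (cong (_≡ᵇ j) (deg≡ w))))
      (≡-sym (sum-permute (λ w → ind (adj H v w ∧ hasDegree H j w)) ρ))

  vtype-iso : ((π , _) : Isomorphic G H) → ∀ u → vtype G u ≡ vtype H (π ⟨$⟩ʳ u)
  vtype-iso (π , hom) u = vtype-permute π (hom u) λ w → degree-permute π (hom w)

-- Complements

-- Each vertex of the class is adjacent to `v` in exactly one of the two graphs or is `v` itself,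
-- which `ind (p v)` accounts for. The additive form avoids truncated subtraction.
neighbours-complement : (G : Graph n) → ∀ v p →
  neighbours G v p + (neighbours (complement G) v p + ind (p v)) ≡ sum (ind ∘ p)
neighbours-complement G v p = ≡-sym (begin
  sum (ind ∘ p) ≡⟨ sum-cong-≗ split ⟩
  sum (λ u → f u + (g u + h u)) ≡⟨ ∑-distrib-+ f (λ u → g u + h u) ⟩
  sum f + sum (λ u → g u + h u) ≡⟨ cong (sum f +_) (∑-distrib-+ g h) ⟩
  sum f + (sum g + sum h)       ≡⟨ cong (λ x → sum f + (sum g + x)) (sum-≟ v p) ⟩
  sum f + (sum g + ind (p v))   ∎)
  where
  open ≡-Reasoning
  f g h : Fin _ → ℕ
  f u = ind (adj G v u ∧ p u)
  g u = ind (adj (complement G) v u ∧ p u)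
  h u = ind (⌊ v ≟ u ⌋ ∧ p u)
  split : ∀ u → ind (p u) ≡ f u + (g u + h u)
  split u with v ≟ u
  ... | yes refl rewrite irrefl G v = refl
  ... | no  _ with adj G v u | p u
  ...   | true  | true  = refl
  ...   | true  | false = refl
  ...   | false | true  = refl
  ...   | false | false = refl

degree-complement : (G : Graph n) → ∀ v → degree G v + (degree (complement G) v + 1) ≡ n
degree-complement {n} G v = begin
  degree G v + (degree (complement G) v + 1) ≡⟨ cong₂ (λ x y → x + (y + 1)) (as-neighbours G) (as-neighbours (complement G)) ⟩
  _                                          ≡⟨ neighbours-complement G v (const true) ⟩
  sum {n} (const 1)                          ≡⟨ sum-const-1 n ⟩
  n                                          ∎
  where
  open ≡-Reasoning
  as-neighbours : ∀ K → degree K v ≡ neighbours K v (const true)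
  as-neighbours K = ≡-trans (degree-sum K v) (sum-cong-≗ λ u → cong ind (≡-sym (Bool.∧-identityʳ (adj K v u))))

-- With `d` and `e` the degrees of a vertex in a graph and in its complement, `e` is `j` exactly
-- when `d` is `n - 1 - j`. Hence a degree class of the complement is a degree class of the graph.
complementary-degree : ∀ n j → ∃ λ k → ∀ d e → d + (e + 1) ≡ n → (e ≡ᵇ j) ≡ (d ≡ᵇ k)
complementary-degree n j with j <? n
... | yes j<n = n ∸ (j + 1) , λ d e d+e → does-⇔ (mk⇔
        (λ { refl → ≡-trans (≡-sym (m+n∸n≡m d (e + 1))) (cong (_∸ (e + 1)) d+e) })
        (λ { refl → +-cancelʳ-≡ 1 e j (+-cancelˡ-≡ d _ _ (≡-trans d+e (≡-sym (m∸n+n≡m (subst (_≤ n) (+-comm 1 j) j<n))))) }))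
      (e ℕ.≟ j) (d ℕ.≟ n ∸ (j + 1))
-- Degrees are below `n`, so the class of `j` is empty, and `n` serves as the index of another empty
-- class.
... | no  j≮n = n , λ d e d+e → does-⇔ (mk⇔
        (λ { refl → ⊥-elim (j≮n (subst (_≤ n) (+-comm e 1) (≤-trans (m≤n+m (e + 1) d) (≤-reflexive d+e)))) })
        (λ { refl → ⊥-elim (m≢1+m+n d {e} (≡-sym (≡-trans (≡-sym (≡-trans (cong (d +_) (+-comm e 1)) (+-suc d e))) d+e))) }))
      (e ℕ.≟ j) (d ℕ.≟ n)

module _ (G H : Graph n) (same-degrees : ∀ j → sum (ind ∘ hasDegree G j) ≡ sum (ind ∘ hasDegree H j)) where

  -- Removing from a degree class the neighbours of a vertex, and the vertex itself if it lies
  -- there, leaves its neighbours in the complement. All quantities removed agree for `u` and `v`.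
  vtype-complement : ∀ {u v} → vtype G u ≡ vtype H v → vtype (complement G) u ≡ vtype (complement H) v
  vtype-complement {u} {v} e = neighbours⇒vtype (complement G) (complement H) same
    where
    open ≡-Reasoning
    same : ∀ j → neighbours (complement G) u (hasDegree (complement G) j)
               ≡ neighbours (complement H) v (hasDegree (complement H) j)
    same j with k , dual ← complementary-degree n j = begin
      neighbours (complement G) u (hasDegree (complement G) j) ≡⟨ reclass G u ⟩
      neighbours (complement G) u (hasDegree G k)              ≡⟨ cancelled ⟩
      neighbours (complement H) v (hasDegree H k)              ≡⟨ reclass H v ⟨
      neighbours (complement H) v (hasDegree (complement H) j) ∎
      where
      reclass : ∀ K x → neighbours (complement K) x (hasDegree (complement K) j) ≡ neighbours (complement K) x (hasDegree K k)
      reclass K x = sum-cong-≗ λ w → cong (λ b → ind (adj (complement K) x w ∧ b)) (dual (degree K w) (degree (complement K) w) (degree-complement K w))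
      cancelled : neighbours (complement G) u (hasDegree G k) ≡ neighbours (complement H) v (hasDegree H k)
      cancelled = +-cancelʳ-≡ (ind (hasDegree G k u)) _ _ (+-cancelˡ-≡ (neighbours G u (hasDegree G k)) _ _ (begin
        neighbours G u (hasDegree G k) + (neighbours (complement G) u (hasDegree G k) + ind (hasDegree G k u))
          ≡⟨ neighbours-complement G u (hasDegree G k) ⟩
        sum (ind ∘ hasDegree G k)
          ≡⟨ same-degrees k ⟩
        sum (ind ∘ hasDegree H k)
          ≡⟨ neighbours-complement H v (hasDegree H k) ⟨
        neighbours H v (hasDegree H k) + (neighbours (complement H) v (hasDegree H k) + ind (hasDegree H k v))
          ≡⟨ cong₂ (λ x y → x + (neighbours (complement H) v (hasDegree H k) + ind (y ≡ᵇ k)))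
               (vtype⇒neighbours G H e k) (vtype⇒degree G H e) ⟨
        neighbours G u (hasDegree G k) + (neighbours (complement H) v (hasDegree H k) + ind (hasDegree G k u)) ∎))

adj-complement : (G : Graph n) → ∀ {u v} → u ≢ v → adj (complement G) u v ≡ not (adj G u v)
adj-complement G {u} {v} u≢v with u ≟ v
... | yes u≡v = ⊥-elim (u≢v u≡v)
... | no  _   = refl

-- The double complement has the same adjacency only pointwise, so it is compared with `G` through
-- the identity isomorphism.
vtype-complement-involutive : (G : Graph n) → ∀ v → vtype (complement (complement G)) v ≡ vtype G v
vtype-complement-involutive G = vtype-iso (complement (complement G)) G (Perm.id , same)
  where
  same : ∀ u v → adj (complement (complement G)) u v ≡ adj G u v
  same u v with u ≟ v
  ... | yes refl = ≡-sym (irrefl G u)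
  ... | no  _    = Bool.not-involutive (adj G u v)

-- Switches

-- With `a`, `c` on the left and `b`, `d` on the right, each in the order `false`, `true`, the edges
-- are the pairs of equal index: `ab` and `cd`.
record Switch (G : Graph n) : Set where
  field
    left right   : Bool → Fin n
    left-degree  : degree G (left false) ≡ degree G (left true)
    right-degree : degree G (right false) ≡ degree G (right true)
    left≢right   : ∀ i j → left i ≢ right j
    alternating  : ∀ i j → adj G (left i) (right j) ≡ not (i xor j)

module Switching (G : Graph n) (S : Switch G) where
  open Switch S

  corner : Bool → Bool → Fin n
  corner false = left
  corner true  = right

  corner-degree : ∀ s i j → degree G (corner s i) ≡ degree G (corner s j)
  corner-degree s     false false = refl
  corner-degree s     true  true  = refl
  corner-degree false false true  = left-degree
  corner-degree false true  false = ≡-sym left-degree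
  corner-degree true  false true  = right-degree
  corner-degree true  true  false = ≡-sym right-degree

  left-distinct : left false ≢ left true
  left-distinct e with () ← ≡-trans (≡-sym (alternating false false)) (≡-trans (cong (λ v → adj G v (right false)) e) (alternating true false))

  right-distinct : right false ≢ right true
  right-distinct e with () ← ≡-trans (≡-sym (alternating false false)) (≡-trans (cong (adj G (left false)) e) (alternating false true))

  corner-injective : ∀ s i t j → corner s i ≡ corner t j → (s , i) ≡ (t , j)
  corner-injective false i     true  j     e = ⊥-elim (left≢right i j e)
  corner-injective true  i     false j     e = ⊥-elim (left≢right j i (≡-sym e))
  corner-injective false false false true  e = ⊥-elim (left-distinct e)
  corner-injective false true  false false e = ⊥-elim (left-distinct (≡-sym e))
  corner-injective true  false true  true  e = ⊥-elim (right-distinct e)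
  corner-injective true  true  true  false e = ⊥-elim (right-distinct (≡-sym e))
  corner-injective false false false false e = refl
  corner-injective false true  false true  e = refl
  corner-injective true  false true  false e = refl
  corner-injective true  true  true  true  e = refl

  Outside : Fin n → Set
  Outside u = ∀ s i → u ≢ corner s i

  data Position (u : Fin n) : Set where
    at      : ∀ s i → u ≡ corner s i → Position u
    outside : Outside u → Position u

  position : ∀ u → Position u
  position u with u ≟ left false | u ≟ left true | u ≟ right false | u ≟ right true
  ... | yes e | _     | _     | _     = at false false e
  ... | no _  | yes e | _     | _     = at false true e
  ... | no _  | no _  | yes e | _     = at true false e
  ... | no _  | no _  | no _  | yes e = at true true e
  ... | no p  | no q  | no r  | no s  = outside λ
    { false false → p ; false true → q ; true false → r ; true true → s }

  -- Marks the four pairs between a left and a right corner. As these alternate, inverting all of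
  -- them replaces `ab`, `cd` by `ad`, `cb`.
  crossing : ∀ {u v} → Position u → Position v → Bool
  crossing (at s _ _)  (at t _ _)  = s xor t
  crossing (at _ _ _)  (outside _) = false
  crossing (outside _) _           = false

  toggled : Fin n → Fin n → Bool
  toggled u v = crossing (position u) (position v)

  toggled-corners : ∀ s i t j → toggled (corner s i) (corner t j) ≡ s xor t
  toggled-corners s i t j with position (corner s i) | position (corner t j)
  ... | outside o   | _           = ⊥-elim (o s i refl)
  ... | at _ _ _    | outside o   = ⊥-elim (o t j refl)
  ... | at s′ i′ e | at t′ j′ e′ with refl ← corner-injective s i s′ i′ e | refl ← corner-injective t j t′ j′ e′ = refl

  toggled-outsideˡ : ∀ {u} → Outside u → ∀ v → toggled u v ≡ false
  toggled-outsideˡ {u} o v with position u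
  ... | at s i e  = ⊥-elim (o s i e)
  ... | outside _ = refl

  toggled-sym : ∀ u v → toggled u v ≡ toggled v u
  toggled-sym u v with position u | position v
  ... | at s _ _  | at t _ _  = Bool.xor-comm s t
  ... | at _ _ _  | outside _ = refl
  ... | outside _ | at _ _ _  = refl
  ... | outside _ | outside _ = refl

  toggled-outsideʳ : ∀ {v} → Outside v → ∀ u → toggled u v ≡ false
  toggled-outsideʳ o u = ≡-trans (toggled-sym u _) (toggled-outsideˡ o u)

  toggled-irrefl : ∀ u → toggled u u ≡ false
  toggled-irrefl u with position u
  ... | at s _ _  = Bool.xor-same s
  ... | outside _ = refl

  switched : Graph n
  switched = record
    { adj    = λ u v → toggled u v xor adj G u v
    ; sym    = λ u v → cong₂ _xor_ (toggled-sym u v) (sym G u v)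
    ; irrefl = λ v → cong₂ _xor_ (toggled-irrefl v) (irrefl G v)
    }

  -- `φ` selects the sides whose two corners are exchanged. `const true` gives `(a c)(b d)`;
  -- `toggle-side v` will give the exchange seen from `v`.
  flipAt : (φ : Bool → Bool) → ∀ {u} → Position u → Fin n
  flipAt φ     (at s i _)  = corner s (φ s xor i)
  flipAt φ {u} (outside _) = u

  flip : (Bool → Bool) → Fin n → Fin n
  flip φ u = flipAt φ (position u)

  flip-corner : ∀ φ s i → flip φ (corner s i) ≡ corner s (φ s xor i)
  flip-corner φ s i with position (corner s i)
  ... | outside o  = ⊥-elim (o s i refl)
  ... | at s′ i′ e with refl ← corner-injective s i s′ i′ e = refl

  flip-outside : ∀ φ {u} → Outside u → flip φ u ≡ u
  flip-outside φ {u} o with position u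
  ... | at s i e  = ⊥-elim (o s i e)
  ... | outside _ = refl

  flip-involutive : ∀ φ u → flip φ (flip φ u) ≡ u
  flip-involutive φ u with position u
  ... | outside o     = flip-outside φ o
  ... | at s i refl = ≡-trans (flip-corner φ s (φ s xor i)) (cong (corner s)
        (≡-trans (≡-sym (Bool.xor-assoc (φ s) (φ s) i)) (cong (_xor i) (Bool.xor-same (φ s)))))

  flip-permutation : (Bool → Bool) → Permutation n n
  flip-permutation φ = permutation (flip φ) (flip φ) (flip-involutive φ) (flip-involutive φ)

  flip-degree : ∀ φ u → degree G u ≡ degree G (flip φ u)
  flip-degree φ u with position u
  ... | outside o   = refl
  ... | at s i refl = corner-degree s i (φ s xor i)

  -- Between opposite sides, adjacency depends only on whether the indices agree, so inverting it
  -- amounts to changing one index; on the same side nothing happens.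
  alternating-flipʳ : ∀ t j s i → (t xor s) xor adj G (corner t j) (corner s i) ≡ adj G (corner t j) (corner s ((t xor s) xor i))
  alternating-flipʳ false j false i = refl
  alternating-flipʳ true  j true  i = refl
  alternating-flipʳ false j true  i = ≡-trans (cong not (alternating j i)) (≡-trans (flipped j i) (≡-sym (alternating j (not i))))
    where
    flipped : ∀ j i → not (not (j xor i)) ≡ not (j xor not i)
    flipped false i = refl
    flipped true  i = refl
  alternating-flipʳ true  j false i = begin
    not (adj G (right j) (left i))  ≡⟨ cong not (≡-trans (sym G (right j) (left i)) (alternating i j)) ⟩
    not (not (i xor j))             ≡⟨ cong not (Bool.not-distribˡ-xor i j) ⟩
    not (not i xor j)               ≡⟨ alternating (not i) j ⟨
    adj G (left (not i)) (right j)  ≡⟨ sym G (left (not i)) (right j) ⟩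
    adj G (right j) (left (not i))  ∎
    where open ≡-Reasoning

  -- Selects the side opposite to a corner `v`, and no side if `v` is not a corner. The index
  -- `false` is an arbitrary representative of side `s`.
  toggle-side : Fin n → Bool → Bool
  toggle-side v s = toggled v (corner s false)

  -- Seen from a single vertex, switching merely exchanges the two corners of the opposite side,
  -- which have equal degrees.
  switched-flip : ∀ v u → adj switched v u ≡ adj G v (flip (toggle-side v) u)
  switched-flip v u = by-position (position v) (position u)
    where
    open ≡-Reasoning
    by-position : ∀ {v u} → Position v → Position u → adj switched v u ≡ adj G v (flip (toggle-side v) u)
    by-position {v} {u} _ (outside o) = begin
      toggled v u xor adj G v u              ≡⟨ cong (_xor adj G v u) (toggled-outsideʳ o v) ⟩
      adj G v u                              ≡⟨ cong (adj G v) (flip-outside (toggle-side v) o) ⟨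
      adj G v (flip (toggle-side v) u)       ∎
    by-position {v} (outside o) (at s i refl) = begin
      toggled v (corner s i) xor adj G v (corner s i) ≡⟨ cong (_xor adj G v (corner s i)) (toggled-outsideˡ o (corner s i)) ⟩
      adj G v (corner s i)                            ≡⟨ cong (λ b → adj G v (corner s (b xor i))) (toggled-outsideˡ o (corner s false)) ⟨
      adj G v (corner s (toggle-side v s xor i))      ≡⟨ cong (adj G v) (flip-corner (toggle-side v) s i) ⟨
      adj G v (flip (toggle-side v) (corner s i))     ∎
    by-position (at t j refl) (at s i refl) = begin
      toggled v′ (corner s i) xor adj G v′ (corner s i) ≡⟨ cong (_xor adj G v′ (corner s i)) (toggled-corners t j s i) ⟩
      (t xor s) xor adj G v′ (corner s i)               ≡⟨ alternating-flipʳ t j s i ⟩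
      adj G v′ (corner s ((t xor s) xor i))             ≡⟨ cong (λ b → adj G v′ (corner s (b xor i))) (toggled-corners t j s false) ⟨
      adj G v′ (corner s (toggle-side v′ s xor i))      ≡⟨ cong (adj G v′) (flip-corner (toggle-side v′) s i) ⟨
      adj G v′ (flip (toggle-side v′) (corner s i))     ∎
      where v′ = corner t j

  vtype-switched : ∀ v → vtype switched v ≡ vtype G v
  vtype-switched v = vtype-permute switched G (ρ v) {v} {v} (switched-flip v) λ w →
    -- Two flips occur: that of `w` shows that its degree is unchanged by switching, that of `v`
    -- moves `w` to a vertex of the same degree.
    ≡-trans (degree-permute switched G (ρ w) {w} {w} (switched-flip w)) (flip-degree (toggle-side v) w)
    where
    ρ : Fin n → Permutation n n
    ρ w = flip-permutation (toggle-side w)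

  switched≢ : adj switched (left false) (right false) ≢ adj G (left false) (right false)
  switched≢ e with () ← ≡-trans (≡-sym (≡-trans e (alternating false false)))
                                (cong₂ _xor_ (toggled-corners false false true false) (alternating false false))

  -- With at most one further vertex, exchanging the two left corners and the
  -- two right corners is an automorphism: the equal degrees of exchanged
  -- corners decide their adjacencies to that vertex.
  module _ (outside-unique : ∀ {x y} → Outside x → Outside y → x ≡ y) where

    private
      π : Fin n → Fin n
      π = flip (const true)

    adj-π-corners : ∀ s i t j → adj G (corner s i) (corner t j) ≡ adj G (π (corner s i)) (π (corner t j))
    adj-π-corners s i t j = ≡-trans (opposite s i t j)
      (≡-sym (cong₂ (adj G) (flip-corner (const true) s i) (flip-corner (const true) t j)))
      where
      same-side : ∀ s i j → adj G (corner s i) (corner s j) ≡ adj G (corner s (not i)) (corner s (not j))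
      same-side s false true  = sym G _ _
      same-side s true  false = sym G _ _
      same-side s false false = ≡-trans (irrefl G _) (≡-sym (irrefl G _))
      same-side s true  true  = ≡-trans (irrefl G _) (≡-sym (irrefl G _))
      across : ∀ i j → adj G (left i) (right j) ≡ adj G (left (not i)) (right (not j))
      across i j = ≡-trans (alternating i j)
        (≡-trans (cong not (≡-sym (Bool.xor-annihilates-not i j))) (≡-sym (alternating (not i) (not j))))
      opposite : ∀ s i t j → adj G (corner s i) (corner t j) ≡ adj G (corner s (not i)) (corner t (not j))
      opposite false i false j = same-side false i j
      opposite true  i true  j = same-side true i j
      opposite false i true  j = across i j
      opposite true  i false j = ≡-trans (sym G _ _) (≡-trans (across j i) (sym G _ _))

    adj-π-outside : ∀ s i {x} → Outside x → adj G (corner s i) x ≡ adj G (π (corner s i)) (π x)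
    adj-π-outside s i {x} o = ind-injective (sum-agree-off same-sum x elsewhere)
      where
      open ≡-Reasoning
      a = corner s i
      same-sum : sum (λ u → ind (adj G a u)) ≡ sum (λ u → ind (adj G (π a) (π u)))
      same-sum = begin
        sum (λ u → ind (adj G a u))           ≡⟨ degree-sum G a ⟨
        degree G a                            ≡⟨ flip-degree (const true) a ⟩
        degree G (π a)                        ≡⟨ degree-sum G (π a) ⟩
        sum (λ u → ind (adj G (π a) u))       ≡⟨ sum-permute (λ u → ind (adj G (π a) u)) (flip-permutation (const true)) ⟩
        sum (λ u → ind (adj G (π a) (π u)))   ∎
      elsewhere : ∀ u → u ≢ x → ind (adj G a u) ≡ ind (adj G (π a) (π u))
      elsewhere u u≢x = by-position (position u) u≢x
        where
        by-position : ∀ {u} → Position u → u ≢ x → ind (adj G a u) ≡ ind (adj G (π a) (π u))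
        by-position (at t j refl) _   = cong ind (adj-π-corners s i t j)
        by-position (outside o′)  u≢x = ⊥-elim (u≢x (outside-unique o′ o))

    adj-π : ∀ u v → adj G u v ≡ adj G (π u) (π v)
    adj-π u v = by-position (position u) (position v)
      where
      by-position : ∀ {u v} → Position u → Position v → adj G u v ≡ adj G (π u) (π v)
      by-position (at s i refl) (at t j refl) = adj-π-corners s i t j
      by-position (at s i refl) (outside o)   = adj-π-outside s i o
      by-position (outside o)   (at s i refl) = ≡-trans (sym G _ _) (≡-trans (adj-π-outside s i o) (sym G _ _))
      by-position (outside o)   (outside o′)  = ≡-sym (cong₂ (adj G) (flip-outside (const true) o) (flip-outside (const true) o′))

    vtype-left : vtype G (left false) ≡ vtype G (left true)
    vtype-left = ≡-trans (vtype-iso G G (flip-permutation (const true) , adj-π) (left false))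
                         (cong (vtype G) (flip-corner (const true) false false))

-- Existence of a switch

transpose-snd : (a c : Fin n) → transpose a c ⟨$⟩ʳ c ≡ a
transpose-snd a c with c ≟ a
... | yes c≡a = c≡a
... | no  _ rewrite dec-true (c ≟ c) refl = refl

transpose-other : {a c u : Fin n} → u ≢ a → u ≢ c → transpose a c ⟨$⟩ʳ u ≡ u
transpose-other {a = a} {c} {u} u≢a u≢c rewrite dec-false (u ≟ a) u≢a | dec-false (u ≟ c) u≢c = refl

-- Compare the neighbourhoods along the transposition of `a` and `c`: a possible edge `ac` is
-- matched with itself, other neighbours of `a` in `p` are neighbours of `c`, and `d` makes the
-- inequality strict.
neighbours-< : (G : Graph n) (p : Fin n → Bool) → ∀ {a c d} → p a ≡ p c →
  (∀ b → adj G a b ≡ true → p b ≡ true → b ≢ c → adj G c b ≡ true) →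
  adj G a d ≡ false → adj G c d ≡ true → p d ≡ true → d ≢ a →
  neighbours G a p < neighbours G c p
neighbours-< G p {a} {c} {d} pa≡pc dominated ad cd pd d≢a =
  subst (neighbours G a p <_) (≡-sym (sum-permute (λ u → ind (adj G c u ∧ p u)) (transpose a c)))
    (sum-mono-< le d lt)
  where
  π : Fin _ → Fin _
  π = transpose a c ⟨$⟩ʳ_
  d≢c : d ≢ c
  d≢c refl with () ← ≡-trans (≡-sym cd) (irrefl G d)
  le : ∀ u → ind (adj G a u ∧ p u) ≤ ind (adj G c (π u) ∧ p (π u))
  le u = by-cases (u ≟ a) (u ≟ c)
    where
    by-cases : Dec (u ≡ a) → Dec (u ≡ c) → ind (adj G a u ∧ p u) ≤ ind (adj G c (π u) ∧ p (π u))
    by-cases (yes refl) _ rewrite irrefl G a = z≤n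
    by-cases (no _) (yes refl) rewrite transpose-snd a c | sym G a c | pa≡pc = ≤-refl
    by-cases (no u≢a) (no u≢c) rewrite transpose-other u≢a u≢c = ind-mono λ e →
      cong₂ _∧_ (dominated u (Bool.∧-conicalˡ _ _ e) (Bool.∧-conicalʳ (adj G a u) _ e) u≢c) (Bool.∧-conicalʳ (adj G a u) _ e)
  lt : ind (adj G a d ∧ p d) < ind (adj G c (π d) ∧ p (π d))
  lt rewrite transpose-other d≢a d≢c | ad | cd | pd = ≤-refl

module _ (G G′ : Graph n)
  (same-neighbours : ∀ v j → neighbours G v (hasDegree G j) ≡ neighbours G′ v (hasDegree G j)) where

  -- A pair ad gained by G′ leads to a pair cd lost by G′ with a and c of equal
  -- degree; either this completes to a switch, or c has more neighbours than a
  -- in the degree class of d, and c gains some d′ of that class.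
  augment : ∀ k i j {a d} → degree G a ≡ i → degree G d ≡ j → adj G a d ≡ false → adj G′ a d ≡ true →
    n < k + neighbours G a (hasDegree G j) → Switch G
  -- `k` bounds the remaining rounds: each uses one unit and raises the neighbour count by at least
  -- one, while the count never exceeds `n`.
  augment zero    i j {a} _ _ _ _ n< = contradiction n< (≤⇒≯ (sum-ind≤n (λ u → adj G a u ∧ hasDegree G j u)))
  augment (suc k) i j {a} {d} da dd ad ad′ n<
    with c , dc′ , dc , ci ← exchange (adj G′ d) (adj G d) (hasDegree G i) (≡-sym (same-neighbours d i)) a
           (≡-trans (sym G′ d a) ad′) (≡-trans (sym G d a) ad) (hasDegree-true G {u = a} da)
    -- The case `b = c` is excluded because `c` is never adjacent to itself, so a non-edge `cb`
    -- would then say nothing.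
    with any? (λ b → (adj G a b Bool.≟ true) ×-dec (adj G c b Bool.≟ false) ×-dec (hasDegree G j b Bool.≟ true) ×-dec ¬? (b ≟ c))
  ... | yes (b , ab , cb , bj , b≢c) = record
    { left         = λ i → if i then c else a
    ; right        = λ i → if i then d else b
    ; left-degree  = ≡-trans da (≡-sym (hasDegree⇒≡ G {u = c} ci))
    ; right-degree = ≡-trans (hasDegree⇒≡ G {u = b} bj) (≡-sym dd)
    ; left≢right   = λ
      { false false refl → contradiction (≡-trans (≡-sym ab) (irrefl G a)) λ ()
      ; false true  refl → contradiction (≡-trans (≡-sym ad′) (irrefl G′ a)) λ ()
      ; true  false refl → b≢c refl
      ; true  true  refl → contradiction (≡-trans (≡-sym dc) (irrefl G c)) λ () }
    ; alternating  = λ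
      { false false → ab ; false true → ad ; true false → cb ; true true → ≡-trans (sym G c d) dc }
    }
  ... | no none
    with d′ , cd , cd′ , d′j ← exchange (adj G c) (adj G′ c) (hasDegree G j) (same-neighbours c j) d
           (≡-trans (sym G c d) dc) (≡-trans (sym G′ c d) dc′) (hasDegree-true G {u = d} dd)
    = augment k i j {c} {d′} dc≡i (hasDegree⇒≡ G {u = d′} d′j) cd cd′ (≤-trans n< (≤-trans
        (≤-reflexive (≡-sym (+-suc k _))) (+-monoʳ-≤ k more)))
    where
    dc≡i : degree G c ≡ i
    dc≡i = hasDegree⇒≡ G {u = c} ci
    more : neighbours G a (hasDegree G j) < neighbours G c (hasDegree G j)
    more = neighbours-< G (hasDegree G j) (cong (_≡ᵇ j) (≡-trans da (≡-sym dc≡i)))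
      (λ b ab bj b≢c → Bool.¬-not λ cb → none (b , ab , cb , bj , b≢c))
      ad (≡-trans (sym G c d) dc) (hasDegree-true G {u = d} dd)
      λ { refl → contradiction (≡-trans (≡-sym ad′) (irrefl G′ a)) λ () }

  switch-exists : ∀ {a b} → adj G a b ≢ adj G′ a b → Switch G
  switch-exists {a} {b} differ with adj G a b in ab | adj G′ a b in ab′
  ... | true  | true  = ⊥-elim (differ refl)
  ... | false | false = ⊥-elim (differ refl)
  ... | false | true  = augment (suc n) _ _ {a} {b} refl refl ab ab′ (s≤s (m≤m+n n _))
  ... | true  | false
    -- A pair `ab` lost by `G′` is balanced at `a` by a gained pair `ad` with `d` in the degree
    -- class of `b`, which reduces to the previous case.
    with d , ad , ad′ , dj ← exchange (adj G a) (adj G′ a) (hasDegree G (degree G b)) (same-neighbours a _) b ab ab′ (hasDegree-true G {u = b} refl)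
    = augment (suc n) _ _ {a} {d} refl (hasDegree⇒≡ G {u = d} dj) ad ad′ (s≤s (m≤m+n n _))

-- Dually vertex-oblique graphs

module DuallyOblique (G : Graph n) (dually-oblique : DuallyVertexOblique G) where

  Ḡ : Graph n
  Ḡ = complement G

  oblique : VertexOblique G
  oblique = proj₁ dually-oblique

  σ σ⁻¹ : Fin n → Fin n
  σ   u = proj₁ (proj₁ (proj₂ dually-oblique) u)
  σ⁻¹ v = proj₁ (proj₂ (proj₂ dually-oblique) v)

  vtype-σ : ∀ u → vtype G u ≡ vtype Ḡ (σ u)
  vtype-σ u = proj₂ (proj₁ (proj₂ dually-oblique) u)

  vtype-σ⁻¹ : ∀ v → vtype G (σ⁻¹ v) ≡ vtype Ḡ v
  vtype-σ⁻¹ v = proj₂ (proj₂ (proj₂ dually-oblique) v)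

  -- Complementing again recovers the types in `G`, so equal types in `Ḡ` give equal types in `G`.
  complement-oblique : VertexOblique Ḡ
  complement-oblique u v e = oblique u v (≡-trans (≡-sym (vtype-complement-involutive G u))
    (≡-trans (vtype-complement Ḡ Ḡ (λ _ → refl) e) (vtype-complement-involutive G v)))

  σ-permutation : Permutation n n
  σ-permutation = permutation σ σ⁻¹
    (λ v → complement-oblique _ _ (≡-trans (≡-sym (vtype-σ (σ⁻¹ v))) (vtype-σ⁻¹ v)))
    (λ u → oblique _ _ (≡-trans (vtype-σ⁻¹ (σ u)) (≡-sym (vtype-σ u))))

  σ-involutive : ∀ u → σ (σ u) ≡ u
  σ-involutive u = complement-oblique _ _ (begin
    vtype Ḡ (σ (σ u))             ≡⟨ vtype-σ (σ u) ⟨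
    vtype G (σ u)                 ≡⟨ vtype-complement-involutive G (σ u) ⟨
    -- Here the defining equation of `σ` at `u` is complemented on both sides.
    vtype (complement Ḡ) (σ u)    ≡⟨ vtype-complement G Ḡ same-degrees (vtype-σ u) ⟨
    vtype Ḡ u                     ∎)
    where
    open ≡-Reasoning
    same-degrees : ∀ j → sum (ind ∘ hasDegree G j) ≡ sum (ind ∘ hasDegree Ḡ j)
    -- `σ` preserves degrees, so it carries the degree classes of `G` onto those of `Ḡ`.
    same-degrees j = ≡-trans (sum-cong-≗ λ u → cong (λ d → ind (d ≡ᵇ j)) (vtype⇒degree G Ḡ {u} {σ u} (vtype-σ u)))
                             (≡-sym (sum-permute (ind ∘ hasDegree Ḡ j) σ-permutation))

  G′ : Graph n
  G′ = record
    { adj    = λ u v → adj Ḡ (σ u) (σ v)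
    ; sym    = λ u v → sym Ḡ (σ u) (σ v)
    ; irrefl = λ v → irrefl Ḡ (σ v)
    }

  vtype-G′ : ∀ v → vtype G v ≡ vtype G′ v
  vtype-G′ v = ≡-trans (vtype-σ v) (≡-sym (vtype-iso G′ Ḡ (σ-permutation , λ _ _ → refl) v))

  -- Degrees in `G` and `G′` agree at every vertex, so the degree classes of `G` serve for both
  -- graphs, as the search for a switch requires.
  same-neighbours : ∀ v j → neighbours G v (hasDegree G j) ≡ neighbours G′ v (hasDegree G j)
  same-neighbours v j = ≡-trans (vtype⇒neighbours G G′ (vtype-G′ v) j)
    (sum-cong-≗ λ u → cong (λ d → ind (adj G′ v u ∧ (d ≡ᵇ j))) (≡-sym (vtype⇒degree G G′ {u} {u} (vtype-G′ u))))

  -- `σ` exchanges `u` and `σ u`, so `G′` has on this pair the adjacency of `Ḡ`.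
  differ-orbit : ∀ {u} → u ≢ σ u → adj G u (σ u) ≢ adj G′ u (σ u)
  differ-orbit {u} u≢σu e = Bool.not-¬ refl (≡-trans e (begin
    adj Ḡ (σ u) (σ (σ u))   ≡⟨ cong (adj Ḡ (σ u)) (σ-involutive u) ⟩
    adj Ḡ (σ u) u           ≡⟨ sym Ḡ (σ u) u ⟩
    adj Ḡ u (σ u)           ≡⟨ adj-complement G u≢σu ⟩
    not (adj G u (σ u))     ∎))
    where open ≡-Reasoning

  differ-fixed : ∀ {u v} → u ≢ v → u ≡ σ u → v ≡ σ v → adj G u v ≢ adj G′ u v
  differ-fixed u≢v u≡σu v≡σv e = Bool.not-¬ refl (≡-trans e
    (≡-trans (cong₂ (adj Ḡ) (≡-sym u≡σu) (≡-sym v≡σv)) (adj-complement G u≢v)))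

  -- Among the vertices 0 and 1, either one is moved and forms a pair with its image, or both are
  -- fixed and form a pair themselves. On fewer than two vertices no two graphs differ.
  some-difference : 2 ≤ n → ∃ λ u → ∃ λ v → adj G u v ≢ adj G′ u v
  some-difference (s≤s (s≤s _)) with zero ≟ σ zero | suc zero ≟ σ (suc zero)
  ... | no  0≢ | _      = _ , _ , differ-orbit 0≢
  ... | yes _  | no  1≢ = _ , _ , differ-orbit 1≢
  ... | yes 0≡ | yes 1≡ = _ , _ , differ-fixed (λ ()) 0≡ 1≡

  module _ (S : Switch G) where
    open Switching G S

    -- G and G′ differ on every pair of vertices that σ maps to itself, whereas
    -- the switch leaves all pairs at a non-corner alone: so a non-corner is fixed
    -- by σ, and there is at most one.
    switched≢G′ : ¬ (∀ u v → adj switched u v ≡ adj G′ u v)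
    switched≢G′ H≡G′ = left-distinct (oblique _ _ (vtype-left outside-unique))
      where
      untouched : ∀ {u} → Outside u → ∀ v → adj G u v ≡ adj G′ u v
      untouched {u} o v = ≡-trans (cong (_xor adj G u v) (≡-sym (toggled-outsideˡ o v))) (H≡G′ u v)
      fixed : ∀ {u} → Outside u → u ≡ σ u
      fixed {u} o with u ≟ σ u
      ... | yes u≡σu = u≡σu
      ... | no  u≢σu = ⊥-elim (differ-orbit u≢σu (untouched o (σ u)))
      outside-unique : ∀ {x y} → Outside x → Outside y → x ≡ y
      outside-unique {x} {y} ox oy with x ≟ y
      ... | yes x≡y = x≡y
      ... | no  x≢y = ⊥-elim (differ-fixed x≢y (fixed ox) (fixed oy) (untouched ox y))

    switched≇G : ¬ Isomorphic switched G
    switched≇G iso@(π , hom) = switched≢ (≡-trans (hom _ _) (cong₂ (adj G) (π-id _) (π-id _)))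
      where
      π-id : ∀ u → π ⟨$⟩ʳ u ≡ u
      π-id u = oblique _ _ (≡-trans (≡-sym (vtype-iso switched G iso u)) (vtype-switched u))

    switched≇Ḡ : ¬ Isomorphic switched Ḡ
    switched≇Ḡ iso@(π , hom) = switched≢G′ λ u v → ≡-trans (hom u v) (cong₂ (adj Ḡ) (π-σ u) (π-σ v))
      where
      π-σ : ∀ u → π ⟨$⟩ʳ u ≡ σ u
      π-σ u = complement-oblique _ _ (≡-trans (≡-sym (vtype-iso switched Ḡ iso u)) (≡-trans (vtype-switched u) (vtype-σ u)))

theorem3 : ∀ (n : ℕ) → 2 ≤ n → (G : Graph n) → DuallyVertexOblique G →
    Σ ℕ λ m → Σ (Graph m) λ H →
    ¬ Isomorphic H G × ¬ Isomorphic H (complement G) × SameVertexTypeSeq H G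
theorem3 n 2≤n G dvo =
  -- Types agree vertex by vertex on the same vertex set, so the two lists are equal and no
  -- rearrangement is required.
  n , switched , switched≇G S , switched≇Ḡ S , ↭-reflexive (map-cong vtype-switched (allFin n))
  where
  open DuallyOblique G dvo
  S : Switch G
  S = switch-exists G G′ same-neighbours (proj₂ (proj₂ (some-difference 2≤n)))
  open Switching G S
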